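{- Let $G$ be a unicyclic graph. Then $$2\alpha(G)\le |\mathrm{corona}(G)|+|\mathrm{core}(G)|\le 2\alpha(G)+1.$$ Moreover, $G$ is a non-König-Egerváry graph if and only if $$|\mathrm{corona}(G)|+|\mathrm{core}(G)|=2\alpha(G)+1.$$
   Context: All graphs are finite, simple and undirected (no loops, no multiple edges). A graph is unicyclic if it is connected and contains exactly one cycle. A set of vertices is independent if no two of its vertices are adjacent; $\alpha(G)$ is the maximum size of an independent set of $G$, and $\Omega(G)$ is the family of all maximum independent sets of $G$ (independent sets of size $\alpha(G)$). Define $\mathrm{core}(G)=\bigcap\{S: S\in\Omega(G)\}$ and $\mathrm{corona}(G)=\bigcup\{S: S\in\Omega(G)\}$. $\mu(G)$ is the maximum size of a matching of $G$. $G$ is a König-Egerváry graph if $\alpha(G)+\mu(G)=|V(G)|$, and a non-König-Egerváry graph otherwise. -}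

module Defs where

open import Data.Fin.Base using (Fin; _<_)
open import Data.Fin.Properties using (all?; _≟_; _<?_)
open import Data.Fin.Subset using (Subset; _∈_; ∣_∣; ⋂; ⋃; inside; outside)
open import Data.Fin.Subset.Properties using (_∈?_)
open import Data.List.Base
  using (List; []; _∷_; _++_; _∷ʳ_; map; filter; length; allFin; cartesianProduct)
open import Data.List.Extrema.Nat using (max)
open import Data.List.Relation.Unary.AllPairs using (AllPairs; allPairs?)
open import Data.List.Relation.Unary.Linked using (Linked)
open import Data.List.Relation.Unary.Unique.Propositional using (Unique)
open import Data.Nat.Base using (ℕ; zero; suc; _+_; _≤_)
import Data.Nat.Properties as ℕ
open import Data.Product.Base using (Σ; _×_; _,_; ∃₂)
open import Data.Sum.Base using (_⊎_)
import Data.Vec.Base as Vec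
open import Function.Bundles using (_⇔_)
open import Level using (0ℓ)
open import Relation.Binary.Core using (Rel)
open import Relation.Binary.Construct.Closure.ReflexiveTransitive using (Star)
open import Relation.Binary.Definitions using (Decidable; Symmetric)
open import Relation.Binary.PropositionalEquality.Core using (_≡_; _≢_)
open import Relation.Nullary.Decidable.Core using (Dec; _×-dec_; _→-dec_; ¬?)
open import Relation.Nullary.Negation.Core using (¬_)
import Relation.Unary as Unary

-- Adjacency is required to be decidable: the edge set of a finite graph is a
-- finite set of pairs of vertices.
record Graph (n : ℕ) : Set₁ where
  infix 4 _~_ _~?_
  field
    _~_    : Rel (Fin n) 0ℓ
    _~?_   : Decidable _~_
    ~-sym  : Symmetric _~_
    ~-irr  : ∀ {v} → ¬ (v ~ v)

subsets : ∀ n → List (Subset n)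
subsets zero    = Vec.[] ∷ []
subsets (suc n) = map (inside Vec.∷_) (subsets n) ++ map (outside Vec.∷_) (subsets n)

sublists : ∀ {A : Set} → List A → List (List A)
sublists []       = [] ∷ []
sublists (x ∷ xs) = map (x ∷_) (sublists xs) ++ sublists xs

Consecutive : ∀ {A : Set} → A → A → List A → Set
Consecutive x y zs = ∃₂ λ as bs → zs ≡ as ++ x ∷ y ∷ bs

-- Two edges, given by their endpoints, with no common endpoint.
Disjoint : ∀ {n} → Rel (Fin n × Fin n) 0ℓ
Disjoint (a , b) (c , d) = (a ≢ c × a ≢ d) × (b ≢ c × b ≢ d)

disjoint? : ∀ {n} → Decidable (Disjoint {n})
disjoint? (a , b) (c , d) =
  (¬? (a ≟ c) ×-dec ¬? (a ≟ d)) ×-dec (¬? (b ≟ c) ×-dec ¬? (b ≟ d))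

module _ {n : ℕ} (G : Graph n) where
  open Graph G

  Connected : Set
  Connected = ∀ u v → Star _~_ u v

  record Cycle : Set where
    field
      start    : Fin n
      rest     : List (Fin n)
      long     : 2 ≤ length rest
      distinct : Unique (start ∷ rest)

    closedWalk : List (Fin n)
    closedWalk = start ∷ rest ∷ʳ start

    field
      linked : Linked _~_ closedWalk

  EdgeOf : Cycle → Rel (Fin n) 0ℓ
  EdgeOf C u v = Consecutive u v closedWalk ⊎ Consecutive v u closedWalk
    where open Cycle C

  -- A Cycle carries a starting point and a direction.  Cycles are compared as
  -- subgraphs, i.e. by their edge sets, which also determine their vertices.
  SameCycle : Rel Cycle 0ℓ
  SameCycle C D = ∀ u v → EdgeOf C u v ⇔ EdgeOf D u v

  Unicyclic : Set
  Unicyclic = Connected × Σ Cycle λ C → ∀ D → SameCycle C D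

  Independent : Unary.Pred (Subset n) 0ℓ
  Independent S = ∀ u v → u ∈ S → v ∈ S → ¬ (u ~ v)

  independent? : Unary.Decidable Independent
  independent? S =
    all? λ u → all? λ v → (u ∈? S) →-dec (v ∈? S) →-dec ¬? (u ~? v)

  -- The first argument of max only serves as the value on the empty list; it
  -- is harmless because ∅ is independent (and, for μ below, a matching).
  α : ℕ
  α = max 0 (map ∣_∣ (filter independent? (subsets n)))

  MaximumIndependent : Unary.Pred (Subset n) 0ℓ
  MaximumIndependent S = Independent S × ∣ S ∣ ≡ α

  maximumIndependent? : Unary.Decidable MaximumIndependent
  maximumIndependent? S = independent? S ×-dec (∣ S ∣ ℕ.≟ α)

  Ω : List (Subset n)
  Ω = filter maximumIndependent? (subsets n)

  core : Subset n
  core = ⋂ Ω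

  corona : Subset n
  corona = ⋃ Ω

  -- Each undirected edge is listed once, smaller endpoint first, so that the
  -- sublists of this list are exactly the sets of edges, and length is size.
  edges : List (Fin n × Fin n)
  edges = filter (λ (u , v) → (u <? v) ×-dec (u ~? v))
                 (cartesianProduct (allFin n) (allFin n))

  matchings : List (List (Fin n × Fin n))
  matchings = filter (allPairs? disjoint?) (sublists edges)

  μ : ℕ
  μ = max 0 (map length matchings)

  KönigEgerváry : Set
  KönigEgerváry = α + μ ≡ n

{-# OPTIONS --safe #-}
-- Repeatedly removing a leaf together with its neighbour, or an isolated vertex,
-- splits V into matched pairs, isolated vertices and a rest K that is empty or
-- has minimum degree 2.  In the latter case K is the unique cycle, without
-- chords: a maximal path through any edge of K closes up to a cycle at both ends,
-- and these two cycles agree.  If |K| is even, alternate vertices of K complete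
-- the leaves and isolated vertices to an independent set whose size and that of
-- the obvious matching add up to n, so G is König-Egerváry.  Every partition of V
-- into matched pairs, isolated vertices and K whose bound on independent sets is
-- attained forces each maximum independent set to contain exactly one end of each
-- pair and all the isolated vertices, so that core and corona together count two
-- for each of these.  With K = ∅ this gives 2α for König-Egerváry graphs; on an
-- odd K, every vertex is in some maximum independent set and none is in all of
-- them, which contributes |K| = 2k + 1 instead of 2k.
module Submission where

open import Defs
open import Data.Fin.Subset using (∣_∣)
open import Data.Nat.Base using (ℕ; _+_; _*_; _≤_)
open import Data.Product.Base using (_×_)
open import Function.Bundles using (_⇔_)
open import Relation.Binary.PropositionalEquality.Core using (_≡_)
open import Relation.Nullary.Negation.Core using (¬_)

open import Data.Bool.Base using (true; false; if_then_else_)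
open import Data.Fin.Base using (Fin; zero; suc)
import Data.Fin.Properties as Fin
open import Data.Fin.Subset using (Subset; inside; ⋂; ⋃)
  renaming (_∈_ to _∈ₛ_; _∉_ to _∉ₛ_; ⊥ to ∅)
open import Data.Fin.Subset.Properties
  using (∉⊥; ∈⊤; x∈p∩q⁺; x∈p∩q⁻; x∈p∪q⁺; x∈p∪q⁻)
  renaming (_∈?_ to _∈ₛ?_)
open import Data.List.Base
  using (List; []; _∷_; _++_; _∷ʳ_; _ʳ++_; map; filter; length; reverse; allFin; tabulate;
         cartesianProduct; initLast; _∷ʳ′_)
open import Data.List.Extrema.Nat using (max; xs≤max; argmax-sel)
import Data.List.Membership.DecPropositional as DecMembership
open import Data.List.Membership.Propositional using (_∈_; _∉_; find; lose)
open import Data.List.Membership.Propositional.Properties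
  using (∈-++⁺ˡ; ∈-++⁺ʳ; ∈-++⁻; ∈-∃++; ∈-filter⁺; ∈-filter⁻; ∈-map⁺; ∈-map⁻; ∈-allFin;
         ∈-cartesianProduct⁺)
open import Data.List.Membership.Propositional.Properties.WithK using (unique∧set⇒bag)
open import Data.List.Properties
  using (++-assoc; ∷-injectiveˡ; ++-identityʳ; length-++; length-map; length-tabulate; map-++; map-tabulate;
         reverse-++; ∷ʳ-injectiveʳ; reverse-involutive; unfold-reverse;
         length-++-sucʳ)
open import Data.List.Relation.Binary.BagAndSetEquality using (∼bag⇒↭)
open import Data.List.Relation.Binary.Permutation.Propositional
  using (_↭_; prep; ↭-refl; ↭-sym; ↭-trans; ↭-reflexive; ↭⇒↭ₛ; module PermutationReasoning)
open import Data.List.Relation.Binary.Permutation.Propositional.Properties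
  using (∈-resp-↭; ↭-length; ↭-reverse; shift; shifts; All-resp-↭; ++-comm; ++⁺; ++⁺ˡ; ++⁺ʳ)
  renaming (map⁺ to map-↭)
import Data.List.Relation.Binary.Permutation.Setoid.Properties as Permutationₛ
open import Data.List.Relation.Unary.All as All using (All; []; _∷_)
import Data.List.Relation.Unary.All.Properties as All
open import Data.List.Relation.Unary.AllPairs as AllPairs using (AllPairs; []; _∷_; allPairs?)
import Data.List.Relation.Unary.AllPairs.Properties as AllPairs
open import Data.List.Relation.Unary.Any as Any using (here; there)
open import Data.List.Relation.Unary.Linked as Linked using (Linked; []; [-]; _∷_)
open import Data.List.Relation.Unary.Unique.Propositional using (Unique)
import Data.List.Relation.Unary.Unique.Propositional.Properties as Unique
open import Data.Nat.Base using (zero; suc; z≤n; s≤s; _<_)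
open import Data.Nat.ListAction using (sum)
open import Data.Nat.ListAction.Properties using (sum-++; sum-↭)
import Data.Nat.Properties as ℕ
open import Data.Nat.Tactic.RingSolver using (solve-∀)
open import Data.Product.Base using (Σ; ∃; ∃₂; _,_; proj₁; proj₂; uncurry)
open import Data.Product.Properties using (≡-dec)
open import Data.Sum.Base using (_⊎_; inj₁; inj₂; [_,_]′)
import Data.Vec.Base as Vec
import Data.Vec.Properties as Vec
open import Function.Base using (_∘_; id; case_of_)
open import Function.Bundles using (mk⇔; Equivalence)
open import Level using (0ℓ)
open import Relation.Binary.Core using (Rel)
open import Relation.Binary.Definitions using (Symmetric)
open import Relation.Binary.PropositionalEquality
  using (refl; sym; trans; cong; cong₂; subst; _≢_; setoid; module ≡-Reasoning)
open import Relation.Nullary.Decidable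
  using (yes; no; does; ¬?; dec-true; dec-false; decidable-stable; _×-dec_)
open import Relation.Nullary.Negation using (contradiction)
import Relation.Unary as Unary

open module ListMembership {n : ℕ} = DecMembership (Fin._≟_ {n}) using (_∈?_)

private variable
  A : Set
  x y z : A
  xs ys zs : List A

-- Lists: flattened pairs, duplicate-free lists and complements.

ends : List (A × A) → List A
ends []             = []
ends ((u , v) ∷ es) = u ∷ v ∷ ends es

ends-++ : ∀ (es fs : List (A × A)) → ends (es ++ fs) ≡ ends es ++ ends fs
ends-++ []             fs = refl
ends-++ ((u , v) ∷ es) fs = cong (λ ws → u ∷ v ∷ ws) (ends-++ es fs)

ends↭ : ∀ (es : List (A × A)) → ends es ↭ map proj₁ es ++ map proj₂ es
ends↭ []             = ↭-refl
ends↭ ((u , v) ∷ es) = prep u (↭-trans (prep v (ends↭ es)) (↭-sym (shift v (map proj₁ es) _)))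

length-ends : ∀ (es : List (A × A)) → length (ends es) ≡ 2 * length es
length-ends []       = refl
length-ends (_ ∷ es) = trans (cong (2 +_) (length-ends es)) (sym (ℕ.*-suc 2 (length es)))

-- Splitting off two entries at a time decides the parity of the length and yields the pairs from
-- which alternate sets on a cycle are read off.
even⊎odd : ∀ (xs : List A) → (∃ λ es → xs ≡ ends es) ⊎ (∃₂ λ es z → xs ≡ ends es ∷ʳ z)
even⊎odd []           = inj₁ ([] , refl)
even⊎odd (x ∷ [])     = inj₂ ([] , x , refl)
even⊎odd (x ∷ y ∷ xs) with even⊎odd xs
... | inj₁ (es , refl)     = inj₁ ((x , y) ∷ es , refl)
... | inj₂ (es , z , refl) = inj₂ ((x , y) ∷ es , z , refl)

Unique-resp-↭ : xs ↭ ys → Unique xs → Unique ys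
Unique-resp-↭ xs↭ys = Permutationₛ.Unique-resp-↭ (setoid _) (↭⇒↭ₛ xs↭ys)

++-disjoint : ∀ (xs : List A) → Unique (xs ++ ys) → x ∈ xs → x ∉ ys
++-disjoint (x ∷ xs) (x∉ ∷ _) (here refl) x∈ys = All.lookup x∉ (∈-++⁺ʳ xs x∈ys) refl
++-disjoint (x ∷ xs) (_ ∷ u)  (there x∈)  x∈ys = ++-disjoint xs u x∈ x∈ys

Unique-++⁻ˡ : ∀ (xs : List A) → Unique (xs ++ ys) → Unique xs
Unique-++⁻ˡ []       _       = []
Unique-++⁻ˡ (x ∷ xs) (x∉ ∷ u) = All.++⁻ˡ xs x∉ ∷ Unique-++⁻ˡ xs u

Unique-++⁻ʳ : ∀ (xs : List A) → Unique (xs ++ ys) → Unique ys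
Unique-++⁻ʳ []       u       = u
Unique-++⁻ʳ (x ∷ xs) (_ ∷ u) = Unique-++⁻ʳ xs u

unique∧set⇒↭ : Unique xs → Unique ys → (∀ {x} → x ∈ xs → x ∈ ys) → (∀ {x} → x ∈ ys → x ∈ xs) →
               xs ↭ ys
unique∧set⇒↭ uxs uys xs⊆ys ys⊆xs = ∼bag⇒↭ (unique∧set⇒bag uxs uys (mk⇔ xs⊆ys ys⊆xs))

complement : ∀ {n} (xs : List (Fin n)) → Unique xs → ∃ λ ys → xs ++ ys ↭ allFin n
complement {n} xs u = rest , unique∧set⇒↭
    (Unique.++⁺ u (Unique.filter⁺ ∉? (Unique.allFin⁺ n))
       (λ (v∈xs , v∈rest) → proj₂ (∈-filter⁻ ∉? {xs = allFin n} v∈rest) v∈xs))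
    (Unique.allFin⁺ n) (λ _ → ∈-allFin _) back
  where
  ∉? = λ v → ¬? (v ∈? xs)
  rest = filter ∉? (allFin n)
  back : ∀ {v} → v ∈ allFin n → v ∈ xs ++ rest
  back {v} v∈ with v ∈? xs
  ... | yes v∈xs = ∈-++⁺ˡ v∈xs
  ... | no  v∉xs = ∈-++⁺ʳ xs (∈-filter⁺ ∉? v∈ v∉xs)

length-allFin : ∀ n → length (allFin n) ≡ n
length-allFin n = length-tabulate {n = n} id

Unique⇒length≤ : ∀ {n} (xs : List (Fin n)) → Unique xs → length xs ≤ n
Unique⇒length≤ {n} xs u = begin
  length xs                ≤⟨ ℕ.m≤m+n _ _ ⟩
  length xs + length rest  ≡⟨ length-++ xs ⟨
  length (xs ++ rest)      ≡⟨ ↭-length (proj₂ (complement xs u)) ⟩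
  length (allFin n)      ≡⟨ length-allFin n ⟩
  n                      ∎
  where
  open ℕ.≤-Reasoning
  rest = proj₁ (complement xs u)

-- Lists whose consecutive entries are related.

Consecutive⇒R : ∀ {R : Rel A 0ℓ} → Linked R xs → Consecutive x y xs → R x y
Consecutive⇒R l (as , bs , refl) = go as l
  where
  go : ∀ as → Linked _ (as ++ _ ∷ _ ∷ bs) → _
  go []           l       = Linked.head l
  go (_ ∷ [])     (_ ∷ l) = Linked.head l
  go (_ ∷ a ∷ as) (_ ∷ l) = go (a ∷ as) l

Linked-++⁻ˡ : ∀ {R : Rel A 0ℓ} xs → Linked R (xs ++ ys) → Linked R xs
Linked-++⁻ˡ []           l       = []
Linked-++⁻ˡ (_ ∷ [])     l       = [-]
Linked-++⁻ˡ (_ ∷ x ∷ xs) (r ∷ l) = r ∷ Linked-++⁻ˡ (x ∷ xs) l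

Linked-∷ʳ : ∀ {R : Rel A 0ℓ} xs → Linked R (xs ∷ʳ x) → R x y → Linked R (xs ∷ʳ x ∷ʳ y)
Linked-∷ʳ []           l       r = r ∷ [-]
Linked-∷ʳ (_ ∷ [])     (s ∷ l) r = s ∷ r ∷ [-]
Linked-∷ʳ (_ ∷ z ∷ xs) (s ∷ l) r = s ∷ Linked-∷ʳ (z ∷ xs) l r

Linked-ʳ++ : ∀ {R : Rel A 0ℓ} → Symmetric R → Linked R (x ∷ xs) → Linked R (x ∷ ys) →
             Linked R (xs ʳ++ (x ∷ ys))
Linked-ʳ++ R-sym [-]     l = l
Linked-ʳ++ R-sym (r ∷ k) l = Linked-ʳ++ R-sym k (R-sym r ∷ l)

Linked-reverse : ∀ {R : Rel A 0ℓ} → Symmetric R → Linked R xs → Linked R (reverse xs)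
Linked-reverse R-sym []           = []
Linked-reverse R-sym l@[-]        = l
Linked-reverse R-sym l@(_ ∷ _)    = Linked-ʳ++ R-sym l [-]

Linked-ends⁻ : ∀ {R : Rel A 0ℓ} es → Linked R (ends es ++ ys) → All (uncurry R) es
Linked-ends⁻ []             _           = []
Linked-ends⁻ ((u , v) ∷ es) (r ∷ l) = r ∷ Linked-ends⁻ es (Linked.tail l)

module _ {P : A → Set} where

  -- The entries satisfying `P` form a vertex cover of the walk. A set on a chordless cycle is shown
  -- independent by giving its complement this property.
  Touching : List A → Set
  Touching = Linked (λ x y → P x ⊎ P y)

  touching-∷ : P x → Touching xs → Touching (x ∷ xs)
  touching-∷ px []      = [-]
  touching-∷ px [-]     = inj₁ px ∷ [-]
  touching-∷ px (r ∷ l) = inj₁ px ∷ r ∷ l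

  -- The step out of a pair relies on the next first entry, which is why the entry `z` after the
  -- last pair must satisfy `P` as well.
  touching-ends₁ : ∀ es → All (P ∘ proj₁) es → P z → Touching (z ∷ ys) → Touching (ends es ++ z ∷ ys)
  touching-ends₁ []             []         pz l = l
  touching-ends₁ (_ ∷ [])       (pu ∷ [])  pz l = inj₁ pu ∷ inj₂ pz ∷ l
  touching-ends₁ (_ ∷ es@(_ ∷ _)) (pu ∷ ps@(pu′ ∷ _)) pz l =
    inj₁ pu ∷ inj₂ pu′ ∷ touching-ends₁ es ps pz l

  -- A second entry covers both the step inside its pair and the step out of it, so nothing is asked
  -- of the head of `ys`.
  touching-ends₂ : ∀ es → All (P ∘ proj₂) es → Touching ys → Touching (ends es ++ ys)
  touching-ends₂ []       []        l = l
  touching-ends₂ (_ ∷ es) (pv ∷ ps) l = inj₂ pv ∷ touching-∷ pv (touching-ends₂ es ps l)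

-- Maxima and sums over lists.

double-≤-odd : ∀ {m k} → 2 * m ≤ suc (2 * k) → m ≤ k
double-≤-odd {m} {k} 2m≤ = ℕ.≮⇒≥ λ k<m →
  ℕ.<-irrefl refl (ℕ.≤-trans (subst (_≤ 2 * m) (ℕ.*-suc 2 k) (ℕ.*-monoʳ-≤ 2 k<m)) 2m≤)

max-attained : ∀ (f : A → ℕ) {xs x} → x ∈ xs → ∃ λ y → y ∈ xs × f y ≡ max 0 (map f xs)
max-attained f {xs} {x} x∈xs with argmax-sel id 0 (map f xs)
... | inj₂ m∈ = let (y , y∈xs , m≡fy) = ∈-map⁻ f m∈ in y , y∈xs , sym m≡fy
-- If the maximum is the default value 0, every value is 0, so the given member attains it.
... | inj₁ m≡0 = x , x∈xs , trans (ℕ.n≤0⇒n≡0 (subst (f x ≤_) m≡0 fx≤m)) (sym m≡0)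
  where fx≤m = All.lookup (xs≤max 0 (map f xs)) (∈-map⁺ f x∈xs)

≤max : ∀ (f : A → ℕ) {xs x} → x ∈ xs → f x ≤ max 0 (map f xs)
≤max f {xs} x∈xs = All.lookup (xs≤max 0 (map f xs)) (∈-map⁺ f x∈xs)

∑ : (A → ℕ) → List A → ℕ
∑ f xs = sum (map f xs)

∑-++ : ∀ (f : A → ℕ) xs ys → ∑ f (xs ++ ys) ≡ ∑ f xs + ∑ f ys
∑-++ f xs ys = trans (cong sum (map-++ f xs ys)) (sum-++ (map f xs) (map f ys))

∑-↭ : ∀ (f : A → ℕ) → xs ↭ ys → ∑ f xs ≡ ∑ f ys
∑-↭ f xs↭ys = sum-↭ (map-↭ f xs↭ys)

∑ₑ : (A → ℕ) → List (A × A) → ℕ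
∑ₑ f = ∑ (λ (u , v) → f u + f v)

∑-ends : ∀ (f : A → ℕ) es → ∑ f (ends es) ≡ ∑ₑ f es
∑-ends f []             = refl
∑-ends f ((u , v) ∷ es) =
  trans (cong (λ s → f u + (f v + s)) (∑-ends f es)) (sym (ℕ.+-assoc (f u) _ _))

∑-+ : ∀ (f g : A → ℕ) xs → ∑ (λ x → f x + g x) xs ≡ ∑ f xs + ∑ g xs
∑-+ f g []       = refl
∑-+ f g (x ∷ xs) = trans (cong (f x + g x +_) (∑-+ f g xs)) (shuffle (f x) (g x) (∑ f xs) (∑ g xs))
  where
  shuffle : ∀ a b c d → a + b + (c + d) ≡ a + c + (b + d)
  shuffle = solve-∀

∑-const : ∀ (f : A → ℕ) c {xs} → All (λ x → f x ≡ c) xs → ∑ f xs ≡ length xs * c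
∑-const f c []           = refl
∑-const f c (fx≡c ∷ all) = cong₂ _+_ fx≡c (∑-const f c all)

∑≤length : ∀ (f : A → ℕ) {xs} → All (λ x → f x ≤ 1) xs → ∑ f xs ≤ length xs
∑≤length f []           = z≤n
∑≤length f (fx≤1 ∷ all) = ℕ.+-mono-≤ fx≤1 (∑≤length f all)

+-tight : ∀ {a b c d} → a ≤ c → b ≤ d → c + d ≤ a + b → a ≡ c × b ≡ d
+-tight {a} {b} {c} {d} a≤c b≤d c+d≤a+b =
    ℕ.≤-antisym a≤c (ℕ.+-cancelʳ-≤ d c a (ℕ.≤-trans c+d≤a+b (ℕ.+-monoʳ-≤ a b≤d)))
  , ℕ.≤-antisym b≤d (ℕ.+-cancelˡ-≤ c d b (ℕ.≤-trans c+d≤a+b (ℕ.+-monoˡ-≤ b a≤c)))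

∑-tight : ∀ (f : A → ℕ) {xs} → All (λ x → f x ≤ 1) xs → length xs ≤ ∑ f xs →
          All (λ x → f x ≡ 1) xs
∑-tight f []           _ = []
∑-tight f (fx≤1 ∷ all) l =
  let (fx≡1 , ∑≡) = +-tight fx≤1 (∑≤length f all) l
  in fx≡1 ∷ ∑-tight f all (ℕ.≤-reflexive (sym ∑≡))

-- Adding the bounds for the `suc (length xs)` steps counts each inner entry twice and each end
-- once. On a closed walk both ends are the same vertex, so every vertex of the cycle is counted
-- twice.
∑-path : ∀ (f : A → ℕ) {x y} xs → Linked (λ u v → f u + f v ≤ 1) (x ∷ xs ∷ʳ y) →
         f x + 2 * ∑ f xs + f y ≤ suc (length xs)
∑-path f {x} {y} []  (r ∷ [-]) = subst (λ s → s + f y ≤ 1) (sym (ℕ.+-identityʳ (f x))) r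
∑-path f {x} {y} (z ∷ xs) (r ∷ l) = begin
  f x + 2 * (f z + ∑ f xs) + f y          ≡⟨ shuffle (f x) (f z) (∑ f xs) (f y) ⟩
  f x + f z + (f z + 2 * ∑ f xs + f y)    ≤⟨ ℕ.+-mono-≤ r (∑-path f xs l) ⟩
  suc (suc (length xs))                   ∎
  where
  open ℕ.≤-Reasoning
  shuffle : ∀ a b c d → a + 2 * (b + c) + d ≡ a + b + (b + 2 * c + d)
  shuffle = solve-∀

-- Subsets as indicator functions and as lists of vertices.

ind : ∀ {n} → Subset n → Fin n → ℕ
ind S v = if does (v ∈ₛ? S) then 1 else 0

module _ {n} (S : Subset n) {v : Fin n} where

  ∈⇒ind≡1 : v ∈ₛ S → ind S v ≡ 1
  ∈⇒ind≡1 v∈S = cong (if_then 1 else 0) (dec-true (v ∈ₛ? S) v∈S)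

  ∉⇒ind≡0 : v ∉ₛ S → ind S v ≡ 0
  ∉⇒ind≡0 v∉S = cong (if_then 1 else 0) (dec-false (v ∈ₛ? S) v∉S)

  ind≡1⇒∈ : ind S v ≡ 1 → v ∈ₛ S
  ind≡1⇒∈ eq with yes v∈S ← v ∈ₛ? S = v∈S

  ind≤1 : ind S v ≤ 1
  ind≤1 with does (v ∈ₛ? S)
  ... | true  = ℕ.≤-refl
  ... | false = z≤n

∣S∣≡∑ : ∀ {n} (S : Subset n) → ∣ S ∣ ≡ ∑ (ind S) (allFin n)
∣S∣≡∑ Vec.[]              = refl
∣S∣≡∑ {suc n} (s Vec.∷ S) = begin
  ∣ s Vec.∷ S ∣                                  ≡⟨ head s ⟩
  ind (s Vec.∷ S) zero + ∣ S ∣                   ≡⟨ cong (ind (s Vec.∷ S) zero +_) (∣S∣≡∑ S) ⟩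
  ind (s Vec.∷ S) zero + ∑ (ind S) (allFin n)    ≡⟨ cong (λ is → ind (s Vec.∷ S) zero + sum is) tail ⟩
  ∑ (ind (s Vec.∷ S)) (allFin (suc n))           ∎
  where
  open ≡-Reasoning
  head : ∀ s → ∣ s Vec.∷ S ∣ ≡ ind (s Vec.∷ S) zero + ∣ S ∣
  head true  = refl
  head false = refl
  tail : map (ind S) (allFin n) ≡ map (ind (s Vec.∷ S)) (tabulate suc)
  tail = trans (map-tabulate id (ind S)) (sym (map-tabulate suc (ind (s Vec.∷ S))))

setOf : ∀ {n} → List (Fin n) → Subset n
setOf xs = Vec.tabulate (λ v → does (v ∈? xs))

module _ {n} {xs : List (Fin n)} {v : Fin n} where

  ∈-setOf⁺ : v ∈ xs → v ∈ₛ setOf xs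
  ∈-setOf⁺ v∈xs = Vec.lookup⇒[]= v _ (trans (Vec.lookup∘tabulate _ v) (dec-true (v ∈? xs) v∈xs))

  ∈-setOf⁻ : v ∈ₛ setOf xs → v ∈ xs
  ∈-setOf⁻ v∈S with v ∈? xs | trans (sym (Vec.lookup∘tabulate _ v)) (Vec.[]=⇒lookup v∈S)
  ... | yes v∈xs | _ = v∈xs

length≤∣setOf∣ : ∀ {n} {xs : List (Fin n)} → Unique xs → length xs ≤ ∣ setOf xs ∣
length≤∣setOf∣ {n} {xs} u = begin
  length xs                    ≡⟨ ℕ.*-identityʳ _ ⟨
  length xs * 1                ≡⟨ ∑-const f 1 {xs} (All.tabulate (∈⇒ind≡1 _ ∘ ∈-setOf⁺)) ⟨
  ∑ f xs                       ≤⟨ ℕ.m≤m+n _ _ ⟩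
  ∑ f xs + ∑ f rest            ≡⟨ ∑-++ f xs rest ⟨
  ∑ f (xs ++ rest)             ≡⟨ ∑-↭ f xs++rest↭ ⟩
  ∑ f (allFin n)               ≡⟨ ∣S∣≡∑ (setOf xs) ⟨
  ∣ setOf xs ∣                 ∎
  where
  open ℕ.≤-Reasoning
  f = ind (setOf xs)
  rest = proj₁ (complement xs u)
  xs++rest↭ = proj₂ (complement xs u)

-- Enumerations of subsets and sublists; intersections and unions.

∈-subsets : ∀ {n} (S : Subset n) → S ∈ subsets n
∈-subsets Vec.[]          = here refl
∈-subsets (true  Vec.∷ S) = ∈-++⁺ˡ (∈-map⁺ _ (∈-subsets S))
∈-subsets (false Vec.∷ S) = ∈-++⁺ʳ (map (inside Vec.∷_) (subsets _)) (∈-map⁺ _ (∈-subsets S))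

filter-∈-sublists : ∀ {P : A → Set} (P? : Unary.Decidable P) xs → filter P? xs ∈ sublists xs
filter-∈-sublists P? []       = here refl
filter-∈-sublists P? (x ∷ xs) with does (P? x)
... | true  = ∈-++⁺ˡ (∈-map⁺ _ (filter-∈-sublists P? xs))
... | false = ∈-++⁺ʳ (map (x ∷_) (sublists xs)) (filter-∈-sublists P? xs)

∈-sublists⇒All : ∀ {P : A → Set} {xs ys} → All P xs → ys ∈ sublists xs → All P ys
∈-sublists⇒All []         (here refl) = []
∈-sublists⇒All {xs = x ∷ xs} (px ∷ pxs) ys∈ with ∈-++⁻ (map (x ∷_) (sublists xs)) ys∈
... | inj₂ ys∈′ = ∈-sublists⇒All pxs ys∈′
... | inj₁ ys∈′ with (zs , zs∈ , refl) ← ∈-map⁻ (x ∷_) ys∈′ = px ∷ ∈-sublists⇒All pxs zs∈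

[]∈sublists : ∀ (xs : List A) → [] ∈ sublists xs
[]∈sublists []       = here refl
[]∈sublists (x ∷ xs) = ∈-++⁺ʳ (map (x ∷_) (sublists xs)) ([]∈sublists xs)

module _ {n} {v : Fin n} where

  ∈-⋂⁺ : ∀ {Ss} → (∀ {S} → S ∈ Ss → v ∈ₛ S) → v ∈ₛ ⋂ Ss
  ∈-⋂⁺ {[]}     _ = ∈⊤
  ∈-⋂⁺ {S ∷ Ss} f = x∈p∩q⁺ (f (here refl) , ∈-⋂⁺ (f ∘ there))

  ∈-⋂⁻ : ∀ {S Ss} → v ∈ₛ ⋂ Ss → S ∈ Ss → v ∈ₛ S
  ∈-⋂⁻ v∈ (here refl) = proj₁ (x∈p∩q⁻ _ _ v∈)
  ∈-⋂⁻ v∈ (there S∈)  = ∈-⋂⁻ (proj₂ (x∈p∩q⁻ _ _ v∈)) S∈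

  ∈-⋃⁺ : ∀ {S Ss} → S ∈ Ss → v ∈ₛ S → v ∈ₛ ⋃ Ss
  ∈-⋃⁺ (here refl) v∈ = x∈p∪q⁺ (inj₁ v∈)
  ∈-⋃⁺ (there S∈)  v∈ = x∈p∪q⁺ (inj₂ (∈-⋃⁺ S∈ v∈))

  ∈-⋃⁻ : ∀ Ss → v ∈ₛ ⋃ Ss → ∃ λ S → S ∈ Ss × v ∈ₛ S
  ∈-⋃⁻ []       v∈ = contradiction v∈ ∉⊥
  ∈-⋃⁻ (S ∷ Ss) v∈ with x∈p∪q⁻ S (⋃ Ss) v∈
  ... | inj₁ v∈S = S , here refl , v∈S
  ... | inj₂ v∈⋃ = let (T , T∈ , v∈T) = ∈-⋃⁻ Ss v∈⋃ in T , there T∈ , v∈T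

-- Maximum independent sets and maximum matchings.

Disjoint⇒≢ : ∀ {n} {e f : Fin n × Fin n} → Disjoint e f → e ≢ f
Disjoint⇒≢ ((a≢c , _) , _) refl = a≢c refl

Disjoint-sym : ∀ {n} {e f : Fin n × Fin n} → Disjoint e f → Disjoint f e
Disjoint-sym ((a≢c , a≢d) , (b≢c , b≢d)) =
  (a≢c ∘ sym , b≢c ∘ sym) , (a≢d ∘ sym , b≢d ∘ sym)

ends-unique⇒disjoint : ∀ {n} (M : List (Fin n × Fin n)) → Unique (ends M) → AllPairs Disjoint M
ends-unique⇒disjoint []            _ = []
ends-unique⇒disjoint ((u , v) ∷ M) ((_ ∷ u∉) ∷ v∉ ∷ uniq) =
  go M u∉ v∉ ∷ ends-unique⇒disjoint M uniq
  where
  go : ∀ M → All (u ≢_) (ends M) → All (v ≢_) (ends M) → All (Disjoint (u , v)) M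
  go []      _               _               = []
  go (_ ∷ M) (u≢a ∷ u≢b ∷ u∉) (v≢a ∷ v≢b ∷ v∉) = ((u≢a , u≢b) , (v≢a , v≢b)) ∷ go M u∉ v∉

module _ {n} (G : Graph n) where
  open Graph G

  ≤α : ∀ {S} → Independent G S → ∣ S ∣ ≤ α G
  ≤α ind = ≤max ∣_∣ (∈-filter⁺ (independent? G) (∈-subsets _) ind)

  ∃-maximumIndependent : ∃ (MaximumIndependent G)
  ∃-maximumIndependent =
    let (S , S∈ , ∣S∣≡α) = max-attained ∣_∣ ∅∈
    in S , proj₂ (∈-filter⁻ (independent? G) {xs = subsets n} S∈) , ∣S∣≡α
    where
    ∅∈ : ∅ ∈ filter (independent? G) (subsets n)
    ∅∈ = ∈-filter⁺ (independent? G) (∈-subsets ∅) (λ _ _ u∈∅ → contradiction u∈∅ ∉⊥)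

  module _ {v : Fin n} where

    ∈-core⁺ : (∀ {S} → MaximumIndependent G S → v ∈ₛ S) → v ∈ₛ core G
    ∈-core⁺ f = ∈-⋂⁺ (λ S∈ → f (proj₂ (∈-filter⁻ (maximumIndependent? G) {xs = subsets n} S∈)))

    ∈-core⁻ : ∀ {S} → v ∈ₛ core G → MaximumIndependent G S → v ∈ₛ S
    ∈-core⁻ v∈ max = ∈-⋂⁻ v∈ (∈-filter⁺ (maximumIndependent? G) (∈-subsets _) max)

    ∈-corona⁺ : ∀ {S} → MaximumIndependent G S → v ∈ₛ S → v ∈ₛ corona G
    ∈-corona⁺ max = ∈-⋃⁺ (∈-filter⁺ (maximumIndependent? G) (∈-subsets _) max)

    ∈-corona⁻ : v ∈ₛ corona G → ∃ λ S → MaximumIndependent G S × v ∈ₛ S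
    ∈-corona⁻ v∈ =
      let (S , S∈ , v∈S) = ∈-⋃⁻ (Ω G) v∈
      in S , proj₂ (∈-filter⁻ (maximumIndependent? G) {xs = subsets n} S∈) , v∈S

  NonAdjacent : List (Fin n) → Set
  NonAdjacent xs = ∀ {u v} → u ∈ xs → v ∈ xs → ¬ (u ~ v)

  setOf-independent : ∀ {xs} → NonAdjacent xs → Independent G (setOf xs)
  setOf-independent na u v u∈ v∈ = na (∈-setOf⁻ u∈) (∈-setOf⁻ v∈)

  length≤α : ∀ {xs} → Unique xs → NonAdjacent xs → length xs ≤ α G
  length≤α u na = ℕ.≤-trans (length≤∣setOf∣ u) (≤α (setOf-independent na))

  setOf-maximum : ∀ {xs} → Unique xs → NonAdjacent xs → length xs ≡ α G →
                  MaximumIndependent G (setOf xs)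
  setOf-maximum u na eq =
      setOf-independent na
    , ℕ.≤-antisym (≤α (setOf-independent na)) (subst (_≤ _) eq (length≤∣setOf∣ u))

  ind-edge : ∀ {S u v} → Independent G S → u ~ v → ind S u + ind S v ≤ 1
  ind-edge {S} {u} {v} indS u~v with u ∈ₛ? S
  ... | no  _   = ind≤1 S {v}
  ... | yes u∈S = s≤s (ℕ.≤-reflexive (∉⇒ind≡0 S {v} (λ v∈S → indS u v u∈S v∈S u~v)))

  Edges : List (Fin n × Fin n) → Set
  Edges = All (uncurry _~_)

  orient : Fin n × Fin n → Fin n × Fin n
  orient (u , v) with u Fin.<? v
  ... | yes _ = u , v
  ... | no  _ = v , u

  orient-edge : ∀ {e} → uncurry _~_ e → orient e ∈ edges G
  orient-edge {u , v} u~v with u Fin.<? v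
  ... | yes u<v = ∈-filter⁺ _ (∈-cartesianProduct⁺ (∈-allFin u) (∈-allFin v)) (u<v , u~v)
  ... | no  u≮v = ∈-filter⁺ _ (∈-cartesianProduct⁺ (∈-allFin v) (∈-allFin u)) (v<u , ~-sym u~v)
    where
    v<u = Fin.≤∧≢⇒< (ℕ.≮⇒≥ u≮v) (λ { refl → ~-irr u~v })

  orient-disjoint : ∀ {e f} → Disjoint e f → Disjoint (orient e) (orient f)
  orient-disjoint {a , b} {c , d} ((a≢c , a≢d) , (b≢c , b≢d))
    with a Fin.<? b | c Fin.<? d
  ... | yes _ | yes _ = (a≢c , a≢d) , (b≢c , b≢d)
  ... | yes _ | no  _ = (a≢d , a≢c) , (b≢d , b≢c)
  ... | no  _ | yes _ = (b≢c , b≢d) , (a≢c , a≢d)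
  ... | no  _ | no  _ = (b≢d , b≢c) , (a≢d , a≢c)

  -- Pairwise disjointness compares different edges only; that the two ends of a single edge differ
  -- comes from irreflexivity of adjacency.
  disjoint⇒ends-unique : ∀ M → Edges M → AllPairs Disjoint M → Unique (ends M)
  disjoint⇒ends-unique []            _            _        = []
  disjoint⇒ends-unique ((u , v) ∷ M) (u~v ∷ M~) (d ∷ ds) =
    ((λ { refl → ~-irr u~v }) ∷ goˡ M d) ∷ goʳ M d ∷ disjoint⇒ends-unique M M~ ds
    where
    goˡ : ∀ M → All (Disjoint (u , v)) M → All (u ≢_) (ends M)
    goˡ []      []                        = []
    goˡ (_ ∷ M) (((≢a , ≢b) , _) ∷ ds) = ≢a ∷ ≢b ∷ goˡ M ds
    goʳ : ∀ M → All (Disjoint (u , v)) M → All (v ≢_) (ends M)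
    goʳ []      []                        = []
    goʳ (_ ∷ M) ((_ , (≢a , ≢b)) ∷ ds) = ≢a ∷ ≢b ∷ goʳ M ds

  length≤μ : ∀ {M} → Edges M → Unique (ends M) → length M ≤ μ G
  length≤μ {M} M~ uniq = begin
    length M    ≡⟨ length-map orient M ⟨
    length M′   ≡⟨ ↭-length F↭M′ ⟨
    length F    ≤⟨ ≤max length F∈matchings ⟩
    μ G         ∎
    where
    open ℕ.≤-Reasoning
    open DecMembership (≡-dec (Fin._≟_ {n}) Fin._≟_) using () renaming (_∈?_ to _∈ₑ?_)
    M′ = map orient M
    -- `matchings` contains only sublists of `edges`, which keep its order, so the oriented matching
    -- is replaced by a permutation of it that is a filter of `edges`.
    F  = filter (_∈ₑ? M′) (edges G)
    M′-disjoint : AllPairs Disjoint M′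
    M′-disjoint = AllPairs.map⁺ (AllPairs.map orient-disjoint (ends-unique⇒disjoint M uniq))
    M′⊆edges : ∀ {e} → e ∈ M′ → e ∈ edges G
    M′⊆edges e∈ with (f , f∈ , refl) ← ∈-map⁻ orient e∈ = orient-edge (All.lookup M~ f∈)
    F↭M′ : F ↭ M′
    F↭M′ = unique∧set⇒↭
      (Unique.filter⁺ (_∈ₑ? M′)
        (Unique.filter⁺ _ (Unique.cartesianProduct⁺ (Unique.allFin⁺ n) (Unique.allFin⁺ n))))
      (AllPairs.map Disjoint⇒≢ M′-disjoint)
      (λ e∈ → proj₂ (∈-filter⁻ (_∈ₑ? M′) {xs = edges G} e∈))
      (λ e∈ → ∈-filter⁺ (_∈ₑ? M′) (M′⊆edges e∈) e∈)
    disjoint : AllPairs Disjoint F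
    disjoint = Permutationₛ.AllPairs-resp-↭ (setoid _) Disjoint-sym
      ((λ { refl d → d }) , (λ { refl d → d })) (↭⇒↭ₛ (↭-sym F↭M′)) M′-disjoint
    F∈matchings : F ∈ matchings G
    F∈matchings =
      ∈-filter⁺ (allPairs? disjoint?) (filter-∈-sublists (_∈ₑ? M′) (edges G)) disjoint

  ∃-maximumMatching : ∃ λ M → Edges M × Unique (ends M) × length M ≡ μ G
  ∃-maximumMatching =
    let (M , M∈ , ∣M∣≡μ) = max-attained length []∈
        (M∈sub , disjoint) = ∈-filter⁻ (allPairs? disjoint?) {xs = sublists (edges G)} M∈
        M~ = ∈-sublists⇒All edges~ M∈sub
    in M , M~ , disjoint⇒ends-unique M M~ disjoint , ∣M∣≡μ
    where
    edges~ : Edges (edges G)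
    edges~ = All.map proj₂ (All.all-filter (λ (u , v) → (u Fin.<? v) ×-dec (u ~? v))
                                          (cartesianProduct (allFin n) (allFin n)))
    []∈ : [] ∈ matchings G
    []∈ = ∈-filter⁺ (allPairs? disjoint?) ([]∈sublists (edges G)) []

  -- If some maximum independent set contains `u`, it misses `v`, so `v` is not in the core; if none
  -- contains `u`, all of them contain `v`.
  complementary : ∀ u v → (∀ {S} → MaximumIndependent G S → ind S u + ind S v ≡ 1) →
                  ind (corona G) u + ind (core G) v ≡ 1
  complementary u v exactly-one with u ∈ₛ? corona G
  ... | yes u∈ = cong suc (∉⇒ind≡0 (core G) {v} v∉core)
    where
    v∉core : v ∉ₛ core G
    v∉core v∈ =
      let (S , max , u∈S) = ∈-corona⁻ u∈
      in case trans (sym (cong₂ _+_ (∈⇒ind≡1 S u∈S) (∈⇒ind≡1 S (∈-core⁻ v∈ max)))) (exactly-one max)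
         of λ ()
  ... | no  u∉ = ∈⇒ind≡1 (core G) (∈-core⁺ λ {S} max →
      ind≡1⇒∈ S {v} (trans (cong (_+ ind S v) (sym (∉⇒ind≡0 S {u} (u∉ ∘ ∈-corona⁺ max)))) (exactly-one max)))

  -- Partitions of the vertices into matched pairs, single vertices and a rest.

  module _ M I K (M~ : Edges M) (V↭ : ends M ++ I ++ K ↭ allFin n) where

    ∑-partition : ∀ f → ∑ f (allFin n) ≡ ∑ₑ f M + (∑ f I + ∑ f K)
    ∑-partition f = begin
      ∑ f (allFin n)                    ≡⟨ ∑-↭ f V↭ ⟨
      ∑ f (ends M ++ I ++ K)            ≡⟨ ∑-++ f (ends M) (I ++ K) ⟩
      ∑ f (ends M) + ∑ f (I ++ K)       ≡⟨ cong₂ _+_ (∑-ends f M) (∑-++ f I K) ⟩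
      ∑ₑ f M + (∑ f I + ∑ f K)          ∎
      where open ≡-Reasoning

    n≡partition : n ≡ 2 * length M + (length I + length K)
    n≡partition = begin
      n                                   ≡⟨ length-allFin n ⟨
      length (allFin n)                   ≡⟨ ↭-length V↭ ⟨
      length (ends M ++ I ++ K)           ≡⟨ length-++ (ends M) ⟩
      length (ends M) + length (I ++ K)   ≡⟨ cong₂ _+_ (length-ends M) (length-++ I) ⟩
      2 * length M + (length I + length K) ∎
      where open ≡-Reasoning

    ∑ₑ-ind≤1 : ∀ {S} → Independent G S → All (λ (u , v) → ind S u + ind S v ≤ 1) M
    ∑ₑ-ind≤1 indS = All.map (ind-edge indS) M~

    ∑-ind≤1 : ∀ {S} → All (λ v → ind S v ≤ 1) I
    ∑-ind≤1 {S} = All.tabulate (λ {v} _ → ind≤1 S {v})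

    module _ {k} (α≡ : α G ≡ length M + (length I + k))
             (K≤k : ∀ {S} → Independent G S → ∑ (ind S) K ≤ k) where

      -- An independent set has at most one end of each pair, at most all of `I` and at most `k`
      -- vertices of `K`. By `α≡` a maximum one reaches the sum of these bounds, hence each of them.
      maximum-tight : ∀ {S} → MaximumIndependent G S →
                      All (λ (u , v) → ind S u + ind S v ≡ 1) M × All (λ v → ind S v ≡ 1) I
      maximum-tight {S} (indS , ∣S∣≡α) =
          ∑-tight _ (∑ₑ-ind≤1 indS) (ℕ.≤-reflexive (sym M-eq))
        , ∑-tight _ ∑-ind≤1 (ℕ.≤-reflexive (sym I-eq))
        where
        open ℕ.≤-Reasoning
        total : length M + (length I + k) ≤ ∑ₑ (ind S) M + (∑ (ind S) I + ∑ (ind S) K)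
        total = begin
          length M + (length I + k)                          ≡⟨ α≡ ⟨
          α G                                                ≡⟨ ∣S∣≡α ⟨
          ∣ S ∣                                              ≡⟨ ∣S∣≡∑ S ⟩
          ∑ (ind S) (allFin n)                               ≡⟨ ∑-partition (ind S) ⟩
          ∑ₑ (ind S) M + (∑ (ind S) I + ∑ (ind S) K)         ∎
        I+K≤ : ∑ (ind S) I + ∑ (ind S) K ≤ length I + k
        I+K≤ = ℕ.+-mono-≤ (∑≤length _ ∑-ind≤1) (K≤k indS)
        M-and-rest = +-tight (∑≤length _ (∑ₑ-ind≤1 indS)) I+K≤ total
        M-eq = proj₁ M-and-rest
        I-eq = proj₁ (+-tight (∑≤length _ ∑-ind≤1) (K≤k indS)
                 (ℕ.≤-reflexive (sym (proj₂ M-and-rest))))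

      -- Each pair and each vertex of `I` contributes 2, so that only the contribution of `K`
      -- remains to be found.
      ∣corona∣+∣core∣ : ∣ corona G ∣ + ∣ core G ∣ ≡
        2 * (length M + length I) + (∑ (ind (corona G)) K + ∑ (ind (core G)) K)
      ∣corona∣+∣core∣ = begin
        ∣ corona G ∣ + ∣ core G ∣
          ≡⟨ cong₂ _+_ (∣S∣≡∑ (corona G)) (∣S∣≡∑ (core G)) ⟩
        ∑ f (allFin n) + ∑ g (allFin n)
          ≡⟨ ∑-+ f g (allFin n) ⟨
        ∑ h (allFin n)
          ≡⟨ ∑-partition h ⟩
        ∑ₑ h M + (∑ h I + ∑ h K)
          ≡⟨ cong₂ _+_ (∑-const _ 2 (All.tabulate M-two))
               (cong₂ _+_ (∑-const h 2 (All.tabulate I-two)) (∑-+ f g K)) ⟩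
        length M * 2 + (length I * 2 + (∑ f K + ∑ g K))
          ≡⟨ collect (length M) (length I) _ ⟩
        2 * (length M + length I) + (∑ f K + ∑ g K)
          ∎
        where
        open ≡-Reasoning
        f = ind (corona G)
        g = ind (core G)
        h = λ v → f v + g v
        collect : ∀ a b c → a * 2 + (b * 2 + c) ≡ 2 * (a + b) + c
        collect = solve-∀
        regroup : ∀ a b c d → a + b + (c + d) ≡ (a + d) + (c + b)
        regroup = solve-∀
        M-two : ∀ {e} → e ∈ M → h (proj₁ e) + h (proj₂ e) ≡ 2
        -- The corona at one end is combined with the core at the other, and `complementary` is
        -- applied in both directions.
        M-two {u , v} e∈ = trans (regroup (f u) (g u) (f v) (g v)) (cong₂ _+_
          (complementary u v λ max → All.lookup (proj₁ (maximum-tight max)) e∈)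
          (complementary v u λ {S} max →
            trans (ℕ.+-comm (ind S v) _) (All.lookup (proj₁ (maximum-tight max)) e∈)))
        I-two : ∀ {v} → v ∈ I → h v ≡ 2
        I-two {v} v∈ =
          -- `I` lies in every maximum independent set; one such set has to exist to place it in the
          -- corona as well.
          let (S₀ , max₀) = ∃-maximumIndependent
              v∈S = λ {S} max → ind≡1⇒∈ S {v} (All.lookup (proj₂ (maximum-tight max)) v∈)
          in cong₂ _+_ (∈⇒ind≡1 (corona G) (∈-corona⁺ max₀ (v∈S max₀)))
                       (∈⇒ind≡1 (core G) (∈-core⁺ v∈S))

  -- Maximum matchings and König-Egerváry graphs.

  record MaximumMatching : Set where
    field
      M I  : List _
      M~   : Edges M
      ∣M∣≡μ : length M ≡ μ G
      V↭   : ends M ++ I ++ [] ↭ allFin n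

  maximumMatching : MaximumMatching
  maximumMatching =
    let (M , M~ , uniq , ∣M∣≡μ) = ∃-maximumMatching
        (I , V↭) = complement (ends M) uniq
    in record
      { M = M; I = I; M~ = M~; ∣M∣≡μ = ∣M∣≡μ
      -- `I` takes all unmatched vertices; the empty list is the rest of the partition.
      ; V↭ = subst (λ J → ends M ++ J ↭ allFin n) (sym (++-identityʳ I)) V↭ }

  -- An independent set has at most one end of each edge of a maximum matching `M` and at most all
  -- of the unmatched `I`, so α ≤ |M| + |I|, while n = 2|M| + |I|.
  α+μ≤n : α G + μ G ≤ n
  α+μ≤n = begin
    α G + μ G                                ≡⟨ cong₂ _+_ (sym ∣S∣≡α) (sym ∣M∣≡μ) ⟩
    ∣ S ∣ + m                                ≡⟨ cong (_+ m) (trans (∣S∣≡∑ S) (∑-partition M I [] M~ V↭ (ind S))) ⟩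
    ∑ₑ (ind S) M + (∑ (ind S) I + 0) + m
      ≤⟨ ℕ.+-monoˡ-≤ m (ℕ.+-mono-≤ (∑≤length _ (∑ₑ-ind≤1 M I [] M~ V↭ indS))
           (ℕ.+-monoˡ-≤ 0 (∑≤length _ (∑-ind≤1 M I [] M~ V↭ {S})))) ⟩
    m + (length I + 0) + m                   ≡⟨ collect m (length I) ⟩
    2 * m + (length I + 0)                   ≡⟨ n≡partition M I [] M~ V↭ ⟨
    n                                        ∎
    where
    open ℕ.≤-Reasoning
    S = proj₁ ∃-maximumIndependent
    indS = proj₁ (proj₂ ∃-maximumIndependent)
    ∣S∣≡α = proj₂ (proj₂ ∃-maximumIndependent)
    open MaximumMatching maximumMatching
    m = length M
    collect : ∀ m i → m + (i + 0) + m ≡ 2 * m + (i + 0)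
    collect = solve-∀

  -- As n = 2|M| + |I| and |M| = μ, the hypothesis says α = |M| + |I|. So the partition with empty
  -- rest attains its bound, with `k` equal to 0.
  KönigEgerváry⇒sum≡2α : KönigEgerváry G → ∣ corona G ∣ + ∣ core G ∣ ≡ 2 * α G
  KönigEgerváry⇒sum≡2α ke = begin
    ∣ corona G ∣ + ∣ core G ∣          ≡⟨ ∣corona∣+∣core∣ M I [] M~ V↭ α≡ (λ _ → z≤n) ⟩
    2 * (length M + length I) + 0      ≡⟨ collect (length M) (length I) ⟩
    2 * (length M + (length I + 0))    ≡⟨ cong (2 *_) α≡ ⟨
    2 * α G                            ∎
    where
    open ≡-Reasoning
    open MaximumMatching maximumMatching
    collect : ∀ m i → 2 * (m + i) + 0 ≡ 2 * (m + (i + 0))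
    collect = solve-∀
    split : ∀ m i → 2 * m + (i + 0) ≡ m + (i + 0) + m
    split = solve-∀
    α≡ : α G ≡ length M + (length I + 0)
    α≡ = ℕ.+-cancelʳ-≡ (length M) _ _ (begin
      α G + length M                       ≡⟨ cong (α G +_) ∣M∣≡μ ⟩
      α G + μ G                            ≡⟨ ke ⟩
      n                                    ≡⟨ n≡partition M I [] M~ V↭ ⟩
      2 * length M + (length I + 0)        ≡⟨ split (length M) (length I) ⟩
      length M + (length I + 0) + length M ∎)

  König-Egerváry⁺ : ∀ {M L} → Edges M → Unique (ends M) → Unique L → NonAdjacent L →
                    length L + length M ≡ n → KönigEgerváry G
  König-Egerváry⁺ M~ uM uL na ≡n = ℕ.≤-antisym α+μ≤n
    (subst (_≤ α G + μ G) ≡n (ℕ.+-mono-≤ (length≤α uL na) (length≤μ M~ uM)))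

-- Cycles from maximal paths.

∷ʳ-last-unique : ∀ {A : Set} {q : A} xs ys zs → xs ++ ys ≡ zs ∷ʳ q → Unique (xs ++ ys) → q ∈ xs →
                 ys ≡ []
∷ʳ-last-unique {q = q} xs ys zs eq uniq q∈xs with initLast ys
... | []       = refl
-- A nonempty `ys` would end in `q`, which would then occur in both parts.
... | ys′ ∷ʳ′ w =
  contradiction (subst (_∈ ys′ ∷ʳ w) w≡q (∈-++⁺ʳ ys′ (here refl))) (++-disjoint xs uniq q∈xs)
  where
  w≡q = ∷ʳ-injectiveʳ (xs ++ ys′) zs (trans (++-assoc xs ys′ _) eq)

module _ {n} (G : Graph n) where
  open Graph G

  vertices : Cycle G → List (Fin n)
  vertices D = Cycle.start D ∷ Cycle.rest D

  closedWalk⊆vertices : ∀ D {v} → v ∈ Cycle.closedWalk D → v ∈ vertices D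
  closedWalk⊆vertices D v∈ with ∈-++⁻ (vertices D) v∈
  ... | inj₁ v∈D         = v∈D
  ... | inj₂ (here refl) = here refl

  EdgeOf⇒∈ : ∀ D {u v} → EdgeOf G D u v → u ∈ vertices D
  EdgeOf⇒∈ D (inj₁ (as , bs , eq)) =
    closedWalk⊆vertices D (subst (_ ∈_) (sym eq) (∈-++⁺ʳ as (here refl)))
  EdgeOf⇒∈ D (inj₂ (as , bs , eq)) =
    closedWalk⊆vertices D (subst (_ ∈_) (sym eq) (∈-++⁺ʳ as (there (here refl))))

  start-edge : ∀ D → ∃ (EdgeOf G D (Cycle.start D))
  start-edge record { start = s ; rest = []    ; long = () }
  start-edge record { start = s ; rest = r ∷ _ } = r , inj₁ ([] , _ , refl)

  -- Stated with an arbitrary vertex `w` to be avoided: with the successor of a path's head for `w`,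
  -- it gives the neighbour that closes a cycle.
  MinDegree≥2 : List (Fin n) → Set
  MinDegree≥2 H = ∀ {v} w → v ∈ H → ∃ λ u → u ∈ H × v ~ u × u ≢ w

  module _ (H : List (Fin n)) where

    record IsPath (P : List (Fin n)) : Set where
      field
        linked : Linked _~_ P
        unique : Unique P
        within : All (_∈ H) P
    open IsPath

    HeadMaximal : Fin n → List (Fin n) → Set
    HeadMaximal p P = ∀ {u} → u ∈ H → p ~ u → u ∈ p ∷ P

    -- The path grows at its head until no new neighbour in `H` is left. Having no repetitions it
    -- has at most n vertices, so the fuel cannot run out. The prefix `as` records that the old path
    -- survives as a suffix.
    extend : ∀ fuel p P → n < length (p ∷ P) + fuel → IsPath (p ∷ P) →
             ∃₂ λ q Q → ∃ λ as → q ∷ Q ≡ as ++ p ∷ P × IsPath (q ∷ Q) × HeadMaximal q Q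
    extend zero p P n< path = contradiction n<
      (ℕ.≤⇒≯ (subst (_≤ n) (sym (ℕ.+-identityʳ _)) (Unique⇒length≤ _ (path .unique))))
    extend (suc fuel) p P n< path with Any.any? (λ u → (p ~? u) ×-dec ¬? (u ∈? (p ∷ P))) H
    ... | yes any =
      let (u , u∈H , p~u , u∉) = find any
          (q , Q , as , eq , path′ , max) =
            extend fuel u (p ∷ P) (subst (n <_) (ℕ.+-suc _ fuel) n<) record
            { linked = ~-sym p~u ∷ path .linked
            ; unique = All.¬Any⇒All¬ (p ∷ P) u∉ ∷ path .unique
            ; within = u∈H ∷ path .within }
      in q , Q , as ∷ʳ u , trans eq (sym (++-assoc as (u ∷ []) (p ∷ P))) , path′ , max
    ... | no ¬any = p , P , [] , refl , path , λ {u} u∈H p~u →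
      decidable-stable (u ∈? (p ∷ P)) (λ u∉ → ¬any (lose u∈H (p~u , u∉)))

    reversePath : ∀ {P} → IsPath P → IsPath (reverse P)
    reversePath {P} path = record
      { linked = Linked-reverse ~-sym (path .linked)
      ; unique = Unique-resp-↭ (↭-sym (↭-reverse P)) (path .unique)
      ; within = All-resp-↭ (↭-sym (↭-reverse P)) (path .within) }

    -- The head has a neighbour other than its successor, and by maximality it lies on the path. The
    -- initial segment up to it closes to a cycle, and `bs` is the part of the path left over.
    headCycle : ∀ {p P} → MinDegree≥2 H → IsPath (p ∷ P) → HeadMaximal p P →
                ∃₂ λ D bs → Cycle.start D ≡ p × vertices D ++ bs ≡ p ∷ P
    headCycle {p} {[]} δ path max with δ p (All.head (path .within))
    ... | u , u∈H , p~u , u≢p with here refl ← max u∈H p~u = contradiction refl u≢p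
    headCycle {p} {p₁ ∷ P} δ path max with δ p₁ (All.head (path .within))
    ... | u , u∈H , p~u , u≢p₁ with max u∈H p~u
    ... | here refl         = contradiction p~u ~-irr
    ... | there (here refl) = contradiction refl u≢p₁
    ... | there (there u∈P) with (as , bs , refl) ← ∈-∃++ u∈P =
      record
        { start    = p
        ; rest     = p₁ ∷ as ∷ʳ u
        ; long     = s≤s (subst (1 ≤_) (sym (length-++-sucʳ as u [])) (s≤s z≤n))
        ; distinct = Unique-++⁻ˡ _ (subst Unique (sym eq) (path .unique))
        ; linked   = Linked-∷ʳ (p ∷ p₁ ∷ as)
            (Linked-++⁻ˡ _ (subst (Linked _~_) (sym eq) (path .linked))) (~-sym p~u)
        } , bs , refl , eq
      where
      eq : (p ∷ p₁ ∷ as ∷ʳ u) ++ bs ≡ p ∷ p₁ ∷ as ++ u ∷ bs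
      eq = cong (λ ws → p ∷ p₁ ∷ ws) (++-assoc as (u ∷ []) bs)

    module _ (same : ∀ D E → SameCycle G D E) (δ : MinDegree≥2 H) where

      -- The cycles closed up at the two ends of a maximal path through an edge
      -- coincide, so the path is spanned by that cycle.
      cycleThrough : ∀ {x y} → x ∈ H → y ∈ H → x ~ y →
                     Σ (Cycle G) λ D → All (_∈ H) (vertices D) × EdgeOf G D x y
      cycleThrough {x} {y} x∈H y∈H x~y
        with extend n x (y ∷ []) (s≤s (ℕ.m≤n+m n 1)) record
               { linked = x~y ∷ [-]
               ; unique = ((λ { refl → ~-irr x~y }) ∷ []) ∷ [] ∷ []
               ; within = x∈H ∷ y∈H ∷ [] }
      ... | q , Q , as , q∷Q≡ , path₁ , max₁
        -- Reversed, the path has its other end `y` at the head and is prolonged there; `q` is now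
        -- its last vertex.
        with extend n y (x ∷ reverse as) (s≤s (ℕ.m≤n+m n _))
               (subst IsPath (trans (cong reverse q∷Q≡) (reverse-++ as (x ∷ y ∷ []))) (reversePath path₁))
      ... | r , R , bs , r∷R≡ , path₂ , max₂ =
        D , subst (All (_∈ H)) (sym D≡) (path₂ .within)
          -- The final path passes from `y` to `x`, against the given direction.
          , inj₂ (bs , reverse as ∷ʳ Cycle.start D ,
                  trans (cong (_∷ʳ Cycle.start D) (trans D≡ r∷R≡)) (++-assoc bs _ _))
        where
        reversed : reverse (r ∷ R) ≡ q ∷ (Q ++ reverse bs)
        reversed = begin
          reverse (r ∷ R)                                  ≡⟨ cong reverse r∷R≡ ⟩
          reverse (bs ++ y ∷ x ∷ reverse as)               ≡⟨ reverse-++ bs _ ⟩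
          reverse (y ∷ x ∷ reverse as) ++ reverse bs       ≡⟨ cong (λ ws → reverse ws ++ reverse bs)
                                                                   (reverse-++ as (x ∷ y ∷ [])) ⟨
          reverse (reverse (as ++ x ∷ y ∷ [])) ++ reverse bs ≡⟨ cong (_++ reverse bs) (reverse-involutive _) ⟩
          (as ++ x ∷ y ∷ []) ++ reverse bs                 ≡⟨ cong (_++ reverse bs) q∷Q≡ ⟨
          q ∷ (Q ++ reverse bs)                            ∎
          where open ≡-Reasoning
        r∷R≡∷ʳ : r ∷ R ≡ reverse (Q ++ reverse bs) ∷ʳ q
        r∷R≡∷ʳ = trans (sym (reverse-involutive (r ∷ R))) (trans (cong reverse reversed) (unfold-reverse q (Q ++ reverse bs)))
        front = headCycle δ path₂ max₂
        D = proj₁ front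
        ds = proj₁ (proj₂ front)
        D++ds≡ = proj₂ (proj₂ (proj₂ front))
        -- The path stays maximal at `q`, because the second extension only made it longer.
        back = headCycle δ (subst IsPath reversed (reversePath path₂))
                 (λ u∈H q~u → ∈-++⁺ˡ (max₁ u∈H q~u))
        E = proj₁ back
        -- `q` starts `E`, and `E` has the same edges as `D`, so `q` lies on `D`. As `D` is an
        -- initial segment of a path ending in `q`, nothing is left over.
        q∈D : q ∈ vertices D
        q∈D = let (v , e) = start-edge E in
          subst (_∈ vertices D) (proj₁ (proj₂ (proj₂ back))) (EdgeOf⇒∈ D (Equivalence.to (same E D _ v) e))
        ds≡[] : ds ≡ []
        ds≡[] = ∷ʳ-last-unique (vertices D) ds _ (trans D++ds≡ r∷R≡∷ʳ)
                  (subst Unique (sym D++ds≡) (path₂ .unique)) q∈D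
        D≡ : vertices D ≡ r ∷ R
        D≡ = trans (sym (++-identityʳ _)) (trans (cong (vertices D ++_) (sym ds≡[])) D++ds≡)

  -- `K` lists the vertices in cyclic order, so that alternate vertices can be read off from it; the
  -- last component excludes chords.
  InducedCycle : List (Fin n) → Set
  InducedCycle K = Σ (Cycle G) λ D → vertices D ≡ K × (∀ {u v} → u ∈ K → v ∈ K → u ~ v → EdgeOf G D u v)

  -- Every edge inside the list lies on a cycle by `cycleThrough`, and all cycles agree, so one
  -- cycle `D` has all these edges. Each vertex has such an edge and hence lies on `D`.
  minDegree≥2⇒cycle : (∀ D E → SameCycle G D E) → ∀ {h H} → MinDegree≥2 (h ∷ H) → Unique (h ∷ H) →
                      ∃ λ K → InducedCycle K × K ↭ h ∷ H
  minDegree≥2⇒cycle same {h} {H} δ uniq =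
    vertices D , (D , refl , λ u∈ v∈ → edge (All.lookup D⊆H u∈) (All.lookup D⊆H v∈)) ,
    unique∧set⇒↭ (Cycle.distinct D) uniq (All.lookup D⊆H) H⊆D
    where
    first = δ h (here refl)
    through = cycleThrough (h ∷ H) same δ (here refl) (proj₁ (proj₂ first)) (proj₁ (proj₂ (proj₂ first)))
    D = proj₁ through
    D⊆H = proj₁ (proj₂ through)
    edge : ∀ {u v} → u ∈ h ∷ H → v ∈ h ∷ H → u ~ v → EdgeOf G D u v
    edge {u} {v} u∈ v∈ u~v =
      let (E , _ , e) = cycleThrough (h ∷ H) same δ u∈ v∈ u~v in Equivalence.to (same E D u v) e
    H⊆D : ∀ {v} → v ∈ h ∷ H → v ∈ vertices D
    H⊆D {v} v∈ = let (u , u∈ , v~u , _) = δ v v∈ in EdgeOf⇒∈ D (edge v∈ u∈ v~u)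

  -- Removing leaves and isolated vertices.

  Sparse : List (Fin n) → List (Fin n) → Set
  Sparse L K = ∀ {u v} → u ∈ L → v ∈ L ++ K → ¬ (u ~ v)

  Sparse-∷ : ∀ {L K x} → (∀ {v} → v ∈ L ++ K → ¬ (x ~ v)) → Sparse L K → Sparse (x ∷ L) K
  Sparse-∷         x≁ sp (here refl) (here refl) = ~-irr
  Sparse-∷         x≁ sp (here refl) (there v∈)  = x≁ v∈
  Sparse-∷         x≁ sp (there u∈)  (here refl) = x≁ (∈-++⁺ˡ u∈) ∘ ~-sym
  Sparse-∷         x≁ sp (there u∈)  (there v∈)  = sp u∈ v∈

  Sparse-resp-↭ : ∀ {L L′ K} → L ↭ L′ → Sparse L K → Sparse L′ K
  Sparse-resp-↭ {K = K} L↭L′ sp u∈ v∈ =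
    sp (∈-resp-↭ (↭-sym L↭L′) u∈) (∈-resp-↭ (++⁺ʳ K (↭-sym L↭L′)) v∈)

  -- The result of removing leaves together with their neighbours, and isolated
  -- vertices, as long as possible: M consists of pairs (leaf , neighbour).
  record Stripping (H : List (Fin n)) : Set where
    field
      M      : List (Fin n × Fin n)
      I K    : List (Fin n)
      M~     : Edges G M
      H↭     : ends M ++ I ++ K ↭ H
      sparse : Sparse (map proj₁ M ++ I) K
      end    : K ≡ [] ⊎ InducedCycle K

    leaf⊆H : ∀ {v} → v ∈ (map proj₁ M ++ I) ++ K → v ∈ H
    leaf⊆H v∈ = ∈-resp-↭ H↭ (go (∈-++⁻ (map proj₁ M) (subst (_ ∈_) (++-assoc (map proj₁ M) I K) v∈)))
      where
      go : ∀ {v} → v ∈ map proj₁ M ⊎ v ∈ I ++ K → v ∈ ends M ++ I ++ K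
      go (inj₁ v∈M) = ∈-++⁺ˡ (∈-resp-↭ (↭-sym (ends↭ M)) (∈-++⁺ˡ v∈M))
      go (inj₂ v∈)  = ∈-++⁺ʳ (ends M) v∈

  neighbours : List (Fin n) → Fin n → List (Fin n)
  neighbours H v = filter (v ~?_) H

  addIsolated : ∀ {H v} → (∀ {u} → u ∈ H → ¬ (v ~ u)) → Stripping H → Stripping (v ∷ H)
  addIsolated {H} {v} v≁ s = record
    { M = M; I = v ∷ I; K = K; M~ = M~; end = end
    ; H↭ = ↭-trans (shift v (ends M) (I ++ K)) (prep v H↭)
    ; sparse = Sparse-resp-↭ (↭-sym (shift v (map proj₁ M) I)) (Sparse-∷ (v≁ ∘ leaf⊆H) sparse)
    }
    where open Stripping s

  -- Only the leaf `v` has to be nonadjacent to what remains: its neighbour `u` becomes a second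
  -- component of `M`, on which `sparse` puts no condition.
  addLeaf : ∀ {H v u} → v ~ u → (∀ {w} → w ∈ H → ¬ (v ~ w)) → Stripping H → Stripping (v ∷ u ∷ H)
  addLeaf {H} {v} {u} v~u v≁ s = record
    { M = (v , u) ∷ M; I = I; K = K; M~ = v~u ∷ M~; end = end
    ; H↭ = prep v (prep u H↭)
    ; sparse = Sparse-∷ (v≁ ∘ leaf⊆H) sparse
    }
    where open Stripping s

  Stripping-resp-↭ : ∀ {H H′} → H ↭ H′ → Stripping H → Stripping H′
  Stripping-resp-↭ H↭H′ s = record
    { M = M; I = I; K = K; M~ = M~; H↭ = ↭-trans H↭ H↭H′; sparse = sparse; end = end }
    where open Stripping s

  remove : ∀ {v : Fin n} {H} → v ∈ H → ∃ λ H′ → v ∷ H′ ↭ H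
  remove v∈H with (as , bs , refl) ← ∈-∃++ v∈H = as ++ bs , ↭-sym (shift _ as bs)

  -- Of two distinct neighbours at least one differs from `w`.
  minDegree≥2⁺ : ∀ {H} → Unique H → (∀ {v} → v ∈ H → 2 ≤ length (neighbours H v)) → MinDegree≥2 H
  minDegree≥2⁺ {H} uniq 2≤ {v} w v∈H
    with neighbours H v | 2≤ v∈H | Unique.filter⁺ (v ~?_) uniq
       | (λ {u} → ∈-filter⁻ (v ~?_) {v = u} {xs = H})
  ... | a ∷ b ∷ _ | _ | (a≢b ∷ _) ∷ _ | nb with a Fin.≟ w
  ...   | no  a≢w  = a , proj₁ (nb (here refl)) , proj₂ (nb (here refl)) , a≢w
  ...   | yes refl = b , proj₁ (nb (there (here refl))) , proj₂ (nb (there (here refl))) , a≢b ∘ sym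
  minDegree≥2⁺ uniq 2≤ w v∈H | _ ∷ [] | s≤s () | _ | _

  -- Either every vertex of a nonempty `H` has two neighbours in it, and `H` is the cycle, or some
  -- vertex has at most one and is removed, with that neighbour if it exists. The bound `k` carries
  -- the recursion, since the smaller list is not a subterm of `H`.
  strip : (∀ D E → SameCycle G D E) → ∀ k H → length H ≤ k → Unique H → Stripping H
  strip same _       []      _  _    = record
    { M = []; I = []; K = []; M~ = []; H↭ = ↭-refl; sparse = λ (); end = inj₁ refl }
  strip same (suc k) H@(_ ∷ _) (s≤s ≤k) uniq with Any.any? (λ v → length (neighbours H v) ℕ.≤? 1) H
  ... | no ¬low =
    let (K , cycle , K↭H) = minDegree≥2⇒cycle same
          (minDegree≥2⁺ uniq (λ v∈H → ℕ.≰⇒> (λ low → ¬low (lose v∈H low)))) uniq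
    in record { M = []; I = []; K = K; M~ = []; H↭ = K↭H; sparse = λ (); end = inj₂ cycle }
  ... | yes low with find low
  ... | v , v∈H , deg≤1 with remove v∈H
  ... | H′ , vH′↭H with neighbours H v in eq | deg≤1
  ... | [] | _ = Stripping-resp-↭ vH′↭H
    (addIsolated
      (λ u∈ v~u →
        case subst (_ ∈_) eq (∈-filter⁺ (v ~?_) (∈-resp-↭ vH′↭H (there u∈)) v~u) of λ ())
      (strip same k H′ (subst (_≤ k) (sym (ℕ.suc-injective (↭-length vH′↭H))) ≤k)
        (AllPairs.tail (Unique-resp-↭ (↭-sym vH′↭H) uniq))))
  ... | u ∷ _ ∷ _ | s≤s ()
  ... | u ∷ [] | _ with ∈-filter⁻ (v ~?_) {v = u} {xs = H} (subst (u ∈_) (sym eq) (here refl))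
  ... | u∈H , v~u with ∈-resp-↭ (↭-sym vH′↭H) u∈H
  ... | here refl = contradiction v~u ~-irr
  ... | there u∈H′ with remove u∈H′
  ... | H″ , uH″↭H′ = Stripping-resp-↭ vuH″↭H
    (addLeaf v~u only-u (strip same k H″ ≤k′ (AllPairs.tail (AllPairs.tail vuH″-unique))))
    where
    vuH″↭H = ↭-trans (prep v uH″↭H′) vH′↭H
    vuH″-unique = Unique-resp-↭ (↭-sym vuH″↭H) uniq
    ≤k′ : length H″ ≤ k
    -- Two vertices are gone, while the bound has decreased by one only.
    ≤k′ = ℕ.≤-trans (ℕ.n≤1+n _) (subst (_≤ k) (sym (ℕ.suc-injective (↭-length vuH″↭H))) ≤k)
    only-u : ∀ {w} → w ∈ H″ → ¬ (v ~ w)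
    only-u w∈ v~w with subst (_ ∈_) eq (∈-filter⁺ (v ~?_) (∈-resp-↭ vuH″↭H (there (there w∈))) v~w)
    ... | here refl = Unique.Unique[x∷xs]⇒x∉xs (AllPairs.tail vuH″-unique) w∈

  -- As the cycle is induced, an edge inside `K` is a step of the closed walk, and one end of each
  -- step satisfies `P`.
  touching⇒nonAdjacent : ∀ {P K X} ((D , _) : InducedCycle K) → Touching {P = P} (Cycle.closedWalk D) →
                         (∀ {v} → v ∈ X → v ∈ K) → (∀ {v} → v ∈ X → ¬ P v) → NonAdjacent G X
  touching⇒nonAdjacent {P} (D , _ , edge) touch X⊆K ¬P {u} {v} u∈ v∈ u~v
    with edge (X⊆K u∈) (X⊆K v∈) u~v
  ... | inj₁ uv = [ ¬P u∈ , ¬P v∈ ]′ (Consecutive⇒R touch uv)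
  ... | inj₂ vu = [ ¬P v∈ , ¬P u∈ ]′ (Consecutive⇒R touch vu)

  -- Completing the leaves and isolated vertices by part of the cycle.

  module _ (s : Stripping (allFin n)) where
    open Stripping s

    L : List (Fin n)
    L = map proj₁ M ++ I

    length-L++ : ∀ X → length (L ++ X) ≡ length M + (length I + length X)
    length-L++ X = begin
      length (L ++ X)                              ≡⟨ length-++ L ⟩
      length L + length X                          ≡⟨ cong (_+ length X) (length-++ (map proj₁ M)) ⟩
      length (map proj₁ M) + length I + length X   ≡⟨ cong (λ m → m + length I + length X) (length-map proj₁ M) ⟩
      length M + length I + length X               ≡⟨ ℕ.+-assoc (length M) _ _ ⟩
      length M + (length I + length X)             ∎
      where open ≡-Reasoning

    partition-unique : Unique (ends M ++ I ++ K)
    partition-unique = Unique-resp-↭ (↭-sym H↭) (Unique.allFin⁺ n)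

    K-unique : Unique K
    K-unique = Unique-++⁻ʳ I (Unique-++⁻ʳ (ends M) partition-unique)

    module _ {X Y : List (Fin n)} (K↭ : K ↭ X ++ Y) where

      L++X-unique : Unique (L ++ X)
      L++X-unique = Unique-++⁻ˡ (L ++ X) (Unique-resp-↭ regroup partition-unique)
        where
        open PermutationReasoning
        F = map proj₁ M
        S = map proj₂ M
        regroup : ends M ++ I ++ K ↭ (L ++ X) ++ (S ++ Y)
        regroup = begin
          ends M ++ I ++ K            ↭⟨ ++⁺ (ends↭ M) (++⁺ˡ I K↭) ⟩
          (F ++ S) ++ I ++ X ++ Y     ≡⟨ ++-assoc F S _ ⟩
          F ++ S ++ I ++ X ++ Y       ↭⟨ ++⁺ˡ F (shifts S I) ⟩
          F ++ I ++ S ++ X ++ Y       ↭⟨ ++⁺ˡ F (++⁺ˡ I (shifts S X)) ⟩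
          F ++ I ++ X ++ S ++ Y       ≡⟨ ++-assoc F I _ ⟨
          L ++ X ++ S ++ Y            ≡⟨ ++-assoc L X _ ⟨
          (L ++ X) ++ S ++ Y          ∎

      part⊆K : ∀ {v} → v ∈ X → v ∈ K
      part⊆K v∈X = ∈-resp-↭ (↭-sym K↭) (∈-++⁺ˡ v∈X)

      part-disjoint : ∀ {v} → v ∈ X → v ∉ Y
      part-disjoint = ++-disjoint X (Unique-resp-↭ K↭ K-unique)

      L++X-nonAdjacent : NonAdjacent G X → NonAdjacent G (L ++ X)
      L++X-nonAdjacent na u∈ v∈ with ∈-++⁻ L u∈ | ∈-++⁻ L v∈
      ... | inj₁ u∈L | inj₁ v∈L = sparse u∈L (∈-++⁺ˡ v∈L)
      ... | inj₁ u∈L | inj₂ v∈X = sparse u∈L (∈-++⁺ʳ L (part⊆K v∈X))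
      ... | inj₂ u∈X | inj₁ v∈L = sparse v∈L (∈-++⁺ʳ L (part⊆K u∈X)) ∘ ~-sym
      ... | inj₂ u∈X | inj₂ v∈X = na u∈X v∈X

    -- `M ++ es` is a matching missing only `I`, and `L ++ map proj₁ es` is independent and consists
    -- of `I` and one end of each matched pair, so the sizes add up to n. An empty `K` is the case
    -- of no pairs.
    even⇒KönigEgerváry : ∀ {es} → K ≡ ends es → Edges G es → NonAdjacent G (map proj₁ es) →
                         KönigEgerváry G
    even⇒KönigEgerváry {es} K≡ es~ na = König-Egerváry⁺ G {M ++ es} {L ++ map proj₁ es}
      (All.++⁺ M~ es~)
      (subst Unique (trans (cong (ends M ++_) K≡) (sym (ends-++ M es)))
        (Unique-++⁻ʳ I (Unique-resp-↭ (shifts (ends M) I) partition-unique)))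
      (L++X-unique K↭) (L++X-nonAdjacent K↭ na) (begin
        length (L ++ map proj₁ es) + length (M ++ es)
          ≡⟨ cong₂ _+_ (trans (length-L++ _)
                         (cong (λ k → length M + (length I + k)) (length-map proj₁ es)))
                       (length-++ M) ⟩
        length M + (length I + length es) + (length M + length es)
          ≡⟨ collect (length M) (length I) (length es) ⟩
        2 * length M + (length I + 2 * length es)
          ≡⟨ cong (λ k → 2 * length M + (length I + k))
               (trans (cong length K≡) (length-ends es)) ⟨
        2 * length M + (length I + length K)
          ≡⟨ n≡partition G M I K M~ H↭ ⟨
        n ∎)
      where
      open ≡-Reasoning
      K↭ : K ↭ map proj₁ es ++ map proj₂ es
      K↭ = ↭-trans (↭-reflexive K≡) (ends↭ es)
      collect : ∀ m i k → m + (i + k) + (m + k) ≡ 2 * m + (i + 2 * k)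
      collect = solve-∀

    -- Every step of the closed walk, also the last one back to the start, contains a second vertex
    -- of a pair, so the first vertices are pairwise nonadjacent.
    evenCycle⇒KönigEgerváry : ∀ {es} → InducedCycle K → K ≡ ends es → KönigEgerváry G
    evenCycle⇒KönigEgerváry {es} cycle@(D , D≡K , _) K≡ = even⇒KönigEgerváry K≡
      (Linked-ends⁻ es (subst (Linked _~_) walk≡ (Cycle.linked D)))
      (touching⇒nonAdjacent {P = _∈ map proj₂ es} cycle
        (subst Touching (sym walk≡) (touching-ends₂ es (All.tabulate (∈-map⁺ proj₂)) [-]))
        (part⊆K K↭) (part-disjoint K↭))
      where
      walk≡ : Cycle.closedWalk D ≡ ends es ∷ʳ Cycle.start D
      walk≡ = cong (_∷ʳ Cycle.start D) (trans D≡K K≡)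
      K↭ : K ↭ map proj₁ es ++ map proj₂ es
      K↭ = ↭-trans (↭-reflexive K≡) (ends↭ es)

    -- On an odd cycle a b … z the sets of the first, the second, and the shifted
    -- first vertices of the pairs extend to maximum independent sets: together
    -- they cover the cycle, and the first two are disjoint.
    module OddCycle {a b es z} (cycle : InducedCycle K) (K≡ : K ≡ ends ((a , b) ∷ es) ∷ʳ z) where

      D   = proj₁ cycle
      abs = (a , b) ∷ es
      k   = length abs

      firsts seconds shifted : List (Fin n)
      firsts  = map proj₁ abs
      seconds = map proj₂ abs
      shifted = map proj₁ es ∷ʳ z

      walk≡ : Cycle.closedWalk D ≡ ends abs ++ z ∷ a ∷ []
      walk≡ = trans (cong₂ _∷ʳ_ D≡ (∷-injectiveˡ D≡)) (++-assoc (ends abs) (z ∷ []) (a ∷ []))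
        where D≡ = trans (proj₁ (proj₂ cycle)) K≡

      length-K : length K ≡ suc (2 * k)
      length-K = trans (cong length K≡) (trans (length-++ (ends abs))
        (trans (ℕ.+-comm _ 1) (cong suc (length-ends abs))))

      K↭firsts : K ↭ firsts ++ (seconds ∷ʳ z)
      K↭firsts = ↭-trans (↭-reflexive K≡) (↭-trans (++⁺ʳ (z ∷ []) (ends↭ abs))
        (↭-reflexive (++-assoc firsts seconds _)))

      K↭seconds : K ↭ seconds ++ (firsts ∷ʳ z)
      K↭seconds = ↭-trans K↭firsts (shifts firsts seconds)

      K↭shifted : K ↭ shifted ++ (seconds ∷ʳ a)
      K↭shifted = begin
        K                                          ↭⟨ K↭firsts ⟩
        a ∷ map proj₁ es ++ (seconds ++ z ∷ [])    ↭⟨ prep a (++⁺ˡ (map proj₁ es) (++-comm seconds _)) ⟩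
        a ∷ map proj₁ es ++ (z ∷ seconds)          ≡⟨ cong (a ∷_) (++-assoc (map proj₁ es) (z ∷ []) seconds) ⟨
        a ∷ shifted ++ seconds                     ↭⟨ ++-comm (a ∷ []) (shifted ++ seconds) ⟩
        (shifted ++ seconds) ++ a ∷ []             ≡⟨ ++-assoc shifted seconds _ ⟩
        shifted ++ (seconds ∷ʳ a)                  ∎
        where open PermutationReasoning

      -- The complement `Y` has to cover the whole closed walk, including the steps into `z` and
      -- from `z` back to `a`.
      nonAdjacent : ∀ {X Y} → K ↭ X ++ Y → Touching {P = _∈ Y} (ends abs ++ z ∷ a ∷ []) → NonAdjacent G X
      nonAdjacent K↭ touch = touching⇒nonAdjacent {P = _∈ _} cycle (subst Touching (sym walk≡) touch)
        (part⊆K K↭) (part-disjoint K↭)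

      firsts-nonAdjacent : NonAdjacent G firsts
      firsts-nonAdjacent = nonAdjacent K↭firsts
        (touching-ends₂ abs (All.tabulate (∈-++⁺ˡ ∘ ∈-map⁺ proj₂)) (inj₁ (∈-++⁺ʳ seconds (here refl)) ∷ [-]))

      seconds-nonAdjacent : NonAdjacent G seconds
      seconds-nonAdjacent = nonAdjacent K↭seconds
        (touching-ends₁ abs (All.tabulate (∈-++⁺ˡ ∘ ∈-map⁺ proj₁)) z∈ (inj₁ z∈ ∷ [-]))
        where z∈ = ∈-++⁺ʳ firsts (here refl)

      -- When `a` is exchanged for `z`, the step from `z` to `a` is covered by `a`, and the step
      -- into `z` by the second vertex before it.
      shifted-nonAdjacent : NonAdjacent G shifted
      shifted-nonAdjacent = nonAdjacent K↭shifted
        (touching-ends₂ abs (All.tabulate (∈-++⁺ˡ ∘ ∈-map⁺ proj₂)) (inj₂ (∈-++⁺ʳ seconds (here refl)) ∷ [-]))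

      -- Summing over the 2k + 1 steps of the cycle, each with at most one end in `S`, counts every
      -- vertex twice. So twice the sum is at most 2k + 1, and by parity the sum is at most `k`.
      ∑K≤k : ∀ {S} → Independent G S → ∑ (ind S) K ≤ k
      ∑K≤k {S} indS = double-≤-odd (begin
        2 * ∑ f K                    ≡⟨ cong (λ ws → 2 * ∑ f ws) (proj₁ (proj₂ cycle)) ⟨
        2 * (f a′ + ∑ f (rest D))    ≡⟨ collect (f a′) (∑ f (rest D)) ⟩
        f a′ + 2 * ∑ f (rest D) + f a′
          ≤⟨ ∑-path f (rest D) (Linked.map (ind-edge G indS) (Cycle.linked D)) ⟩
        length (vertices D)          ≡⟨ cong length (proj₁ (proj₂ cycle)) ⟩
        length K                     ≡⟨ length-K ⟩
        suc (2 * k)                  ∎)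
        where
        open ℕ.≤-Reasoning
        open Cycle using (rest)
        f = ind S
        a′ = Cycle.start D
        collect : ∀ x y → 2 * (x + y) ≡ x + 2 * y + x
        collect = solve-∀

      -- The upper bound adds the bounds on the three parts, and `L ++ firsts` attains it.
      α≡ : α G ≡ length M + (length I + k)
      α≡ = ℕ.≤-antisym α≤ ≤α′
        where
        open ℕ.≤-Reasoning
        S = proj₁ (∃-maximumIndependent G)
        indS = proj₁ (proj₂ (∃-maximumIndependent G))
        α≤ : α G ≤ length M + (length I + k)
        α≤ = begin
          α G                                          ≡⟨ proj₂ (proj₂ (∃-maximumIndependent G)) ⟨
          ∣ S ∣                                        ≡⟨ ∣S∣≡∑ S ⟩
          ∑ (ind S) (allFin n)                         ≡⟨ ∑-partition G M I K M~ H↭ (ind S) ⟩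
          ∑ₑ (ind S) M + (∑ (ind S) I + ∑ (ind S) K)
            ≤⟨ ℕ.+-mono-≤ (∑≤length _ (∑ₑ-ind≤1 G M I K M~ H↭ indS))
                 (ℕ.+-mono-≤ (∑≤length _ (∑-ind≤1 G M I K M~ H↭ {S})) (∑K≤k indS)) ⟩
          length M + (length I + k)                    ∎
        ≤α′ : length M + (length I + k) ≤ α G
        ≤α′ = begin
          length M + (length I + k)               ≡⟨ cong (λ j → length M + (length I + j)) (length-map proj₁ abs) ⟨
          length M + (length I + length firsts)   ≡⟨ length-L++ firsts ⟨
          length (L ++ firsts)
            ≤⟨ length≤α G (L++X-unique K↭firsts) (L++X-nonAdjacent K↭firsts firsts-nonAdjacent) ⟩
          α G                                     ∎

      maximum : ∀ {X Y} → K ↭ X ++ Y → NonAdjacent G X → length X ≡ k →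
                MaximumIndependent G (setOf (L ++ X))
      maximum {X} K↭ na ∣X∣≡k = setOf-maximum G (L++X-unique K↭) (L++X-nonAdjacent K↭ na)
        (trans (length-L++ X) (trans (cong (λ j → length M + (length I + j)) ∣X∣≡k) (sym α≡)))

      firsts-maximum : MaximumIndependent G (setOf (L ++ firsts))
      firsts-maximum = maximum K↭firsts firsts-nonAdjacent (length-map proj₁ abs)

      seconds-maximum : MaximumIndependent G (setOf (L ++ seconds))
      seconds-maximum = maximum K↭seconds seconds-nonAdjacent (length-map proj₂ abs)

      shifted-maximum : MaximumIndependent G (setOf (L ++ shifted))
      shifted-maximum = maximum K↭shifted shifted-nonAdjacent
        (trans (length-++ (map proj₁ es)) (trans (ℕ.+-comm _ 1) (cong suc (length-map proj₁ es))))

      K⊆corona : ∀ {v} → v ∈ K → v ∈ₛ corona G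
      K⊆corona v∈K with ∈-++⁻ firsts (∈-resp-↭ K↭firsts v∈K)
      ... | inj₁ v∈ = ∈-corona⁺ G firsts-maximum (∈-setOf⁺ (∈-++⁺ʳ L v∈))
      ... | inj₂ v∈ with ∈-++⁻ seconds v∈
      ...   | inj₁ v∈′         = ∈-corona⁺ G seconds-maximum (∈-setOf⁺ (∈-++⁺ʳ L v∈′))
      ...   | inj₂ (here refl) =
        ∈-corona⁺ G shifted-maximum (∈-setOf⁺ (∈-++⁺ʳ L (∈-++⁺ʳ (map proj₁ es) (here refl))))

      L∩K : ∀ {v} → v ∈ L → v ∉ K
      -- Splitting `K` into itself and nothing shows that `L ++ K` has no duplicates.
      L∩K = ++-disjoint L (L++X-unique {Y = []} (↭-reflexive (sym (++-identityʳ K))))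

      core∩K⊆ : ∀ {X v} → MaximumIndependent G (setOf (L ++ X)) → v ∈ K → v ∈ₛ core G → v ∈ X
      core∩K⊆ {X} max v∈K v∈core = [ (λ v∈L → contradiction v∈K (L∩K v∈L)) , id ]′
        (∈-++⁻ L (∈-setOf⁻ {xs = L ++ X} (∈-core⁻ G v∈core max)))

      K∩core : ∀ {v} → v ∈ K → v ∉ₛ core G
      K∩core v∈K v∈core = part-disjoint K↭firsts
        (core∩K⊆ {firsts} firsts-maximum v∈K v∈core)
        (∈-++⁺ˡ (core∩K⊆ {seconds} seconds-maximum v∈K v∈core))

      sum≡2α+1 : ∣ corona G ∣ + ∣ core G ∣ ≡ 2 * α G + 1
      sum≡2α+1 = begin
        ∣ corona G ∣ + ∣ core G ∣
          ≡⟨ ∣corona∣+∣core∣ G M I K M~ H↭ α≡ ∑K≤k ⟩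
        2 * (length M + length I) + (∑ (ind (corona G)) K + ∑ (ind (core G)) K)
          ≡⟨ cong (2 * (length M + length I) +_) (cong₂ _+_
               (∑-const _ 1 (All.tabulate {xs = K} (∈⇒ind≡1 (corona G) ∘ K⊆corona)))
               (∑-const _ 0 (All.tabulate {xs = K} (∉⇒ind≡0 (core G) ∘ K∩core)))) ⟩
        2 * (length M + length I) + (length K * 1 + length K * 0)
          ≡⟨ cong (λ l → 2 * (length M + length I) + (l * 1 + l * 0)) length-K ⟩
        2 * (length M + length I) + (suc (2 * k) * 1 + suc (2 * k) * 0)
          ≡⟨ collect (length M) (length I) k ⟩
        2 * (length M + (length I + k)) + 1
          ≡⟨ cong (λ j → 2 * j + 1) α≡ ⟨
        2 * α G + 1 ∎
        where
        open ≡-Reasoning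
        collect : ∀ m i k → 2 * (m + i) + (suc (2 * k) * 1 + suc (2 * k) * 0) ≡ 2 * (m + (i + k)) + 1
        collect = solve-∀

    -- Case distinction by the parity of the cycle.

    dichotomy : KönigEgerváry G ⊎ ∣ corona G ∣ + ∣ core G ∣ ≡ 2 * α G + 1
    dichotomy with end
    ... | inj₁ K≡[]  = inj₁ (even⇒KönigEgerváry {[]} K≡[] [] λ ())
    ... | inj₂ cycle with even⊎odd K
    ...   | inj₁ (es , K≡)             = inj₁ (evenCycle⇒KönigEgerváry {es} cycle K≡)
    ...   | inj₂ (_ ∷ _ , _ , K≡)      = inj₂ (OddCycle.sum≡2α+1 cycle K≡)
    -- A cycle has at least three vertices, so an odd one contains at least one pair.
    ...   | inj₂ ([] , _ , K≡)         = contradiction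
      (subst (3 ≤_) (cong length (trans (proj₁ (proj₂ cycle)) K≡)) (s≤s (Cycle.long (proj₁ cycle))))
      λ { (s≤s ()) }

theorem2p4 : ∀ {n : ℕ} (G : Graph n) → Unicyclic G →
    (2 * α G ≤ ∣ corona G ∣ + ∣ core G ∣ × ∣ corona G ∣ + ∣ core G ∣ ≤ 2 * α G + 1)
    × ((¬ KönigEgerváry G) ⇔ ∣ corona G ∣ + ∣ core G ∣ ≡ 2 * α G + 1)
theorem2p4 {n} G (_ , C , unique) = [ fromKönigEgerváry , fromOdd ]′
  (dichotomy G (strip G same n (allFin n) (ℕ.≤-reflexive (length-allFin n)) (Unique.allFin⁺ n)))
  where
  -- Any two cycles agree because both agree with `C`.
  same : ∀ D E → SameCycle G D E
  same D E u v = mk⇔ (Equivalence.to (unique E u v) ∘ Equivalence.from (unique D u v))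
                     (Equivalence.to (unique D u v) ∘ Equivalence.from (unique E u v))
  total = ∣ corona G ∣ + ∣ core G ∣
  Claim = (2 * α G ≤ total × total ≤ 2 * α G + 1) × ((¬ KönigEgerváry G) ⇔ total ≡ 2 * α G + 1)
  2α≢2α+1 : 2 * α G ≢ 2 * α G + 1
  2α≢2α+1 = ℕ.m+1+n≢m (2 * α G) ∘ sym
  fromKönigEgerváry : KönigEgerváry G → Claim
  fromKönigEgerváry ke =
      (ℕ.≤-reflexive (sym eq) , ℕ.≤-trans (ℕ.≤-reflexive eq) (ℕ.m≤m+n _ 1))
    , mk⇔ (contradiction ke) (λ eq′ → contradiction (trans (sym eq) eq′) 2α≢2α+1)
    where eq = KönigEgerváry⇒sum≡2α G ke
  fromOdd : total ≡ 2 * α G + 1 → Claim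
  fromOdd eq =
      (ℕ.≤-trans (ℕ.m≤m+n _ 1) (ℕ.≤-reflexive (sym eq)) , ℕ.≤-reflexive eq)
    , mk⇔ (λ _ → eq) (λ _ ke → 2α≢2α+1 (trans (sym (KönigEgerváry⇒sum≡2α G ke)) eq))
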